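{- Let $(G_m)_{m\in\mathbb{Z}}$ be a generalized Fibonacci sequence and let $n\ge 0$ be an integer. Then $$\begin{aligned} \sum_{k=0}^n (-1)^k k\, G_k G_{n-k} = {}& (-1)^{n+1} \frac{1}{2} n \left( G_{ -1} G_n - G_0 G_{n+1} \right) \\ & + \frac{1}{4} \left(1-(-1)^n\right) \left[ G_2 G_n - (G_{ -1}+G_1) G_{n+1} \right]. \end{aligned}$$
   Context: A generalized Fibonacci sequence is a sequence $(G_m)_{m\in\mathbb{Z}}$ of complex numbers with $G_{m+2}=G_{m+1}+G_m$ for all integers $m$ (with arbitrary seed $G_0,G_1$); in particular $G_{ -1}=G_1-G_0$. -}

module Defs where

open import Algebra.Bundles using (CommutativeRing)
open import Data.Integer.Base as ℤ using (ℤ; +_)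
open import Data.Nat.Base as ℕ using (ℕ)
import Data.Nat.Properties as ℕ
open import Data.Product.Base using (∃-syntax; _×_; _,_; proj₁; proj₂)
open import Data.Rational.Base as ℚ using (ℚ; 0ℚ; 1ℚ; ½; ∣_∣)
import Data.Rational.Properties as ℚ
open import Function.Base using (_$_)
open import Level using (0ℓ)
open import Relation.Binary.Structures using (IsEquivalence)

private
  -- Identities stated over an arbitrary ring so that ℚ and ℝ are not unfolded
  -- when they are checked.
  module Laws (R : CommutativeRing 0ℓ 0ℓ) where
    open CommutativeRing R hiding (_-_)
    open import Algebra.Properties.Ring ring
      using (-1*x≈-x; x[y-z]≈xy-xz; -0#≈0#; -‿involutive; -‿+-comm)
    open import Algebra.Properties.Group +-group using (\\-leftDividesʳ; //-rightDividesˡ)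
    open import Relation.Binary.Reasoning.Setoid setoid

    open import Algebra.Solver.Ring.NaturalCoefficients.Default commutativeSemiring
      using (solve; _:+_; _:*_; _:=_)

    private
      -- The solver only knows semirings: negation is treated as multiplication
      -- by some m.

      assoc-re′ : ∀ m a b c d e f →
        (a * c + m * (b * d)) * e + m * ((a * d + b * c) * f)
        ≈ a * (c * e + m * (d * f)) + m * (b * (c * f + d * e))
      assoc-re′ = solve 7 (λ m a b c d e f →
        (a :* c :+ m :* (b :* d)) :* e :+ m :* ((a :* d :+ b :* c) :* f)
        := a :* (c :* e :+ m :* (d :* f)) :+ m :* (b :* (c :* f :+ d :* e))) refl

      assoc-im′ : ∀ m a b c d e f →
        (a * c + m * (b * d)) * f + (a * d + b * c) * e
        ≈ a * (c * f + d * e) + b * (c * e + m * (d * f))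
      assoc-im′ = solve 7 (λ m a b c d e f →
        (a :* c :+ m :* (b :* d)) :* f :+ (a :* d :+ b :* c) :* e
        := a :* (c :* f :+ d :* e) :+ b :* (c :* e :+ m :* (d :* f))) refl

      diff-+′ : ∀ m p p′ q q′ → (p + q) + m * (p′ + q′) ≈ (p + m * p′) + (q + m * q′)
      diff-+′ = solve 5 (λ m p p′ q q′ →
        (p :+ q) :+ m :* (p′ :+ q′) := (p :+ m :* p′) :+ (q :+ m :* q′)) refl

      neg : ∀ x → - x ≈ - 1# * x
      neg x = sym (-1*x≈-x x)

    diff-+ : ∀ p p′ q q′ → (p + q) + - (p′ + q′) ≈ (p + - p′) + (q + - q′)
    diff-+ p p′ q q′ = begin
      (p + q) + - (p′ + q′)                  ≈⟨ +-congˡ (neg _) ⟩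
      (p + q) + - 1# * (p′ + q′)             ≈⟨ diff-+′ (- 1#) p p′ q q′ ⟩
      (p + - 1# * p′) + (q + - 1# * q′)      ≈⟨ +-cong (+-congˡ (neg _)) (+-congˡ (neg _)) ⟨
      (p + - p′) + (q + - q′)                ∎

    diff-neg : ∀ p q → - p + - (- q) ≈ q + - p
    diff-neg p q = trans (+-congˡ (-‿involutive q)) (+-comm (- p) q)

    neg-diff : ∀ p q → - (p + - q) ≈ q + - p
    neg-diff p q = trans (sym (-‿+-comm p (- q))) (diff-neg p q)

    diff-diff : ∀ p q r → p + - r ≈ (p + - q) + (q + - r)
    diff-diff p q r = begin
      p + - r                    ≈⟨ +-congˡ (\\-leftDividesʳ q (- r)) ⟨
      p + (- q + (q + - r))      ≈⟨ +-assoc p (- q) (q + - r) ⟨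
      (p + - q) + (q + - r)      ∎

    diff-* : ∀ p p′ q q′ → p * q + - (p′ * q′) ≈ p * (q + - q′) + q′ * (p + - p′)
    diff-* p p′ q q′ = begin
      p * q + - (p′ * q′)                               ≈⟨ diff-diff (p * q) (p * q′) (p′ * q′) ⟩
      (p * q + - (p * q′)) + (p * q′ + - (p′ * q′))     ≈⟨ +-congˡ (+-cong (*-comm p q′) (-‿cong (*-comm p′ q′))) ⟩
      (p * q + - (p * q′)) + (q′ * p + - (q′ * p′))     ≈⟨ +-cong (x[y-z]≈xy-xz p q q′) (x[y-z]≈xy-xz q′ p p′) ⟨
      p * (q + - q′) + q′ * (p + - p′)                  ∎

    diff-back : ∀ p q → p ≈ (p + - q) + q
    diff-back p q = sym (//-rightDividesˡ q p)

    assoc-re : ∀ a b c d e f → (a * c + - (b * d)) * e + - ((a * d + b * c) * f)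
             ≈ a * (c * e + - (d * f)) + - (b * (c * f + d * e))
    assoc-re a b c d e f = begin
      _ ≈⟨ +-cong (*-congʳ (+-congˡ (neg _))) (neg _) ⟩
      _ ≈⟨ assoc-re′ (- 1#) a b c d e f ⟩
      _ ≈⟨ +-cong (*-congˡ (+-congˡ (neg _))) (neg _) ⟨
      _ ∎

    assoc-im : ∀ a b c d e f → (a * c + - (b * d)) * f + (a * d + b * c) * e
             ≈ a * (c * f + d * e) + b * (c * e + - (d * f))
    assoc-im a b c d e f = begin
      _ ≈⟨ +-congʳ (*-congʳ (+-congˡ (neg _))) ⟩
      _ ≈⟨ assoc-im′ (- 1#) a b c d e f ⟩
      _ ≈⟨ +-congˡ (*-congˡ (+-congˡ (neg _))) ⟨
      _ ∎

    distrib-re : ∀ a b c d e f → a * (c + e) + - (b * (d + f))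
               ≈ (a * c + - (b * d)) + (a * e + - (b * f))
    distrib-re a b c d e f = begin
      _ ≈⟨ +-cong (distribˡ a c e) (-‿cong (distribˡ b d f)) ⟩
      _ ≈⟨ diff-+ (a * c) (b * d) (a * e) (b * f) ⟩
      _ ∎

    distrib-im : ∀ a b c d e f → a * (d + f) + b * (c + e)
               ≈ (a * d + b * c) + (a * f + b * e)
    distrib-im = solve 6 (λ a b c d e f →
      a :* (d :+ f) :+ b :* (c :+ e) := (a :* d :+ b :* c) :+ (a :* f :+ b :* e)) refl

    identity-re : ∀ a b → 1# * a + - (0# * b) ≈ a
    identity-re a b = begin
      1# * a + - (0# * b)    ≈⟨ +-cong (*-identityˡ a) (trans (-‿cong (zeroˡ b)) -0#≈0#) ⟩
      a + 0#                 ≈⟨ +-identityʳ a ⟩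
      a                      ∎

    identity-im : ∀ a b → 1# * b + 0# * a ≈ b
    identity-im a b = begin
      1# * b + 0# * a    ≈⟨ +-cong (*-identityˡ b) (zeroˡ a) ⟩
      b + 0#             ≈⟨ +-identityʳ b ⟩
      b                  ∎

    comm-re : ∀ a b c d → a * c + - (b * d) ≈ c * a + - (d * b)
    comm-re a b c d = +-cong (*-comm a c) (-‿cong (*-comm b d))

    comm-im : ∀ a b c d → a * d + b * c ≈ c * b + d * a
    comm-im a b c d = trans (+-comm (a * d) (b * c)) (+-cong (*-comm b c) (*-comm a d))

open import Relation.Binary.PropositionalEquality
  using (_≡_; refl; sym; trans; cong; subst)

private
  module Q = Laws ℚ.+-*-commutativeRing

  half-pos : ∀ {ε} → 0ℚ ℚ.< ε → 0ℚ ℚ.< ½ ℚ.* ε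
  half-pos {ε} ε>0 = subst (ℚ._< ½ ℚ.* ε) (ℚ.*-zeroʳ ½) (ℚ.*-monoʳ-<-pos ½ ε>0)

  halves : ∀ ε → ½ ℚ.* ε ℚ.+ ½ ℚ.* ε ≡ ε
  halves ε = trans (sym (ℚ.*-distribʳ-+ ε ½ ½)) (ℚ.*-identityˡ ε)

  ∣p-p∣<ε : ∀ p {ε} → 0ℚ ℚ.< ε → ∣ p ℚ.- p ∣ ℚ.< ε
  ∣p-p∣<ε p {ε} = subst (ℚ._< ε) (sym (cong ∣_∣ (ℚ.+-inverseʳ p)))

  ∣-∣-sym : ∀ p q → ∣ p ℚ.- q ∣ ≡ ∣ q ℚ.- p ∣
  ∣-∣-sym p q = trans (sym (ℚ.∣-p∣≡∣p∣ (p ℚ.- q)))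
    (cong ∣_∣ (Q.neg-diff p q))

  triangle : ∀ {p q r s ε} → r ≡ p ℚ.+ q → ∣ p ∣ ℚ.< ½ ℚ.* ε → ∣ q ∣ ℚ.< ½ ℚ.* ε →
             s ≡ r → ∣ s ∣ ℚ.< ε
  triangle {p} {q} {ε = ε} refl p< q< refl = begin-strict
    ∣ p ℚ.+ q ∣            ≤⟨ ℚ.∣p+q∣≤∣p∣+∣q∣ p q ⟩
    ∣ p ∣ ℚ.+ ∣ q ∣        <⟨ ℚ.+-mono-< p< q< ⟩
    ½ ℚ.* ε ℚ.+ ½ ℚ.* ε    ≡⟨ halves ε ⟩
    ε                      ∎
    where open ℚ.≤-Reasoning

  +-close : ∀ p p′ q q′ {ε} → ∣ p ℚ.- p′ ∣ ℚ.< ½ ℚ.* ε → ∣ q ℚ.- q′ ∣ ℚ.< ½ ℚ.* ε →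
            ∣ (p ℚ.+ q) ℚ.- (p′ ℚ.+ q′) ∣ ℚ.< ε
  +-close p p′ q q′ p≈ q≈ = triangle refl p≈ q≈
    (Q.diff-+ p p′ q q′)

  trans-close : ∀ p q r {ε} → ∣ p ℚ.- q ∣ ℚ.< ½ ℚ.* ε → ∣ q ℚ.- r ∣ ℚ.< ½ ℚ.* ε →
                ∣ p ℚ.- r ∣ ℚ.< ε
  trans-close p q r p≈q q≈r = triangle refl p≈q q≈r
    (Q.diff-diff p q r)

  neg-close : ∀ p q → ∣ ℚ.- p ℚ.- ℚ.- q ∣ ≡ ∣ p ℚ.- q ∣
  neg-close p q = trans
    (cong ∣_∣ (Q.diff-neg p q)) (∣-∣-sym q p)

  module _ (B ε : ℚ) (B>0 : 0ℚ ℚ.< B) (ε>0 : 0ℚ ℚ.< ε) where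
    private instance
      B-pos : ℚ.Positive B
      B-pos = ℚ.positive B>0

      B-nonZero : ℚ.NonZero B
      B-nonZero = ℚ.pos⇒nonZero B

      B⁻¹-pos : ℚ.Positive (ℚ.1/ B)
      B⁻¹-pos = ℚ.1/pos⇒pos B

      B-nonNeg : ℚ.NonNegative B
      B-nonNeg = ℚ.pos⇒nonNeg B

    δ : ℚ
    δ = ℚ.1/ B ℚ.* (½ ℚ.* ε)

    δ>0 : 0ℚ ℚ.< δ
    δ>0 = subst (ℚ._< δ) (ℚ.*-zeroʳ (ℚ.1/ B)) (ℚ.*-monoʳ-<-pos (ℚ.1/ B) (half-pos ε>0))

    bound-* : ∀ p q → ∣ p ∣ ℚ.≤ B → ∣ q ∣ ℚ.< δ → ∣ p ℚ.* q ∣ ℚ.< ½ ℚ.* ε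
    bound-* p q p≤B q<δ = begin-strict
      ∣ p ℚ.* q ∣                      ≡⟨ ℚ.∣p*q∣≡∣p∣*∣q∣ p q ⟩
      ∣ p ∣ ℚ.* ∣ q ∣                  ≤⟨ ℚ.*-monoʳ-≤-nonNeg ∣ q ∣ {{ℚ.nonNegative (ℚ.0≤∣p∣ q)}} p≤B ⟩
      B ℚ.* ∣ q ∣                      <⟨ ℚ.*-monoʳ-<-pos B q<δ ⟩
      B ℚ.* (ℚ.1/ B ℚ.* (½ ℚ.* ε))     ≡⟨ ℚ.*-assoc B (ℚ.1/ B) (½ ℚ.* ε) ⟨
      (B ℚ.* ℚ.1/ B) ℚ.* (½ ℚ.* ε)     ≡⟨ cong (ℚ._* (½ ℚ.* ε)) (ℚ.*-inverseʳ B) ⟩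
      1ℚ ℚ.* (½ ℚ.* ε)                 ≡⟨ ℚ.*-identityˡ (½ ℚ.* ε) ⟩
      ½ ℚ.* ε                          ∎
      where open ℚ.≤-Reasoning

    *-close : ∀ p p′ q q′ → ∣ p ∣ ℚ.≤ B → ∣ q′ ∣ ℚ.≤ B →
              ∣ p ℚ.- p′ ∣ ℚ.< δ → ∣ q ℚ.- q′ ∣ ℚ.< δ →
              ∣ p ℚ.* q ℚ.- p′ ℚ.* q′ ∣ ℚ.< ε
    *-close p p′ q q′ p≤B q′≤B p≈ q≈ = triangle refl
      (bound-* p (q ℚ.- q′) p≤B q≈) (bound-* q′ (p ℚ.- p′) q′≤B p≈)
      (Q.diff-* p p′ q q′)

-- Real numbers: Cauchy sequences of rationals, identified when their
-- difference tends to zero.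

IsCauchy : (ℕ → ℚ) → Set
IsCauchy s = ∀ ε → 0ℚ ℚ.< ε →
  ∃[ N ] ∀ m n → N ℕ.≤ m → N ℕ.≤ n → ∣ s m ℚ.- s n ∣ ℚ.< ε

record ℝ : Set where
  constructor mkℝ
  field
    seq    : ℕ → ℚ
    cauchy : IsCauchy seq

open ℝ public

infix 4 _≈ℝ_
infixl 6 _+ℝ_
infixl 7 _*ℝ_
infix 8 -ℝ_

-- A record, so that x and y can be inferred from x ≈ℝ y.
record _≈ℝ_ (x y : ℝ) : Set where
  constructor mk≈ℝ
  field
    close : ∀ ε → 0ℚ ℚ.< ε → ∃[ N ] ∀ n → N ℕ.≤ n → ∣ seq x n ℚ.- seq y n ∣ ℚ.< ε

open _≈ℝ_ public

private
  ⊔ˡ : ∀ {m n o} → m ℕ.⊔ n ℕ.≤ o → m ℕ.≤ o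
  ⊔ˡ {m} {n} = ℕ.m⊔n≤o⇒m≤o m n

  ⊔ʳ : ∀ {m n o} → m ℕ.⊔ n ℕ.≤ o → n ℕ.≤ o
  ⊔ʳ {m} {n} = ℕ.m⊔n≤o⇒n≤o m n

  1>0 : 0ℚ ℚ.< 1ℚ
  1>0 = ℚ.positive⁻¹ 1ℚ

  eventually-bounded : ∀ x → ∃[ B ] 0ℚ ℚ.< B × ∃[ N ] ∀ n → N ℕ.≤ n → ∣ seq x n ∣ ℚ.≤ B
  eventually-bounded x with cauchy x 1ℚ 1>0
  ... | N , h = 1ℚ ℚ.+ ∣ a ∣ , ℚ.+-mono-<-≤ 1>0 (ℚ.0≤∣p∣ a) , N , λ n N≤n → begin
      ∣ seq x n ∣                    ≡⟨ cong ∣_∣ (Q.diff-back (seq x n) a) ⟩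
      ∣ (seq x n ℚ.- a) ℚ.+ a ∣      ≤⟨ ℚ.∣p+q∣≤∣p∣+∣q∣ (seq x n ℚ.- a) a ⟩
      ∣ seq x n ℚ.- a ∣ ℚ.+ ∣ a ∣    ≤⟨ ℚ.+-monoˡ-≤ ∣ a ∣ (ℚ.<⇒≤ (h n N N≤n ℕ.≤-refl)) ⟩
      1ℚ ℚ.+ ∣ a ∣                   ∎
    where
    a = seq x N
    open ℚ.≤-Reasoning

  eventually-bounded₂ : ∀ x y → ∃[ B ] 0ℚ ℚ.< B × ∃[ N ] ∀ n → N ℕ.≤ n →
                        ∣ seq x n ∣ ℚ.≤ B × ∣ seq y n ∣ ℚ.≤ B
  eventually-bounded₂ x y =
    let B , B>0 , M , h = eventually-bounded x
        C , C>0 , N , k = eventually-bounded y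
    in B ℚ.+ C , ℚ.+-mono-< B>0 C>0 , M ℕ.⊔ N , λ n ≤n →
      ℚ.≤-trans (h n (⊔ˡ ≤n)) (subst (ℚ._≤ B ℚ.+ C) (ℚ.+-identityʳ B) (ℚ.+-monoʳ-≤ B (ℚ.<⇒≤ C>0))) ,
      ℚ.≤-trans (k n (⊔ʳ {M} ≤n)) (subst (ℚ._≤ B ℚ.+ C) (ℚ.+-identityˡ C) (ℚ.+-monoˡ-≤ C (ℚ.<⇒≤ B>0)))

ℚ⇒ℝ : ℚ → ℝ
ℚ⇒ℝ q = mkℝ (λ _ → q) (λ ε ε>0 → 0 , λ _ _ _ _ → ∣p-p∣<ε q ε>0)

0ℝ 1ℝ : ℝ
0ℝ = ℚ⇒ℝ 0ℚ
1ℝ = ℚ⇒ℝ 1ℚ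

abstract
  +-cauchy : ∀ x y → IsCauchy (λ n → seq x n ℚ.+ seq y n)
  +-cauchy x y ε ε>0 =
    let M , h = cauchy x (½ ℚ.* ε) (half-pos ε>0)
        N , k = cauchy y (½ ℚ.* ε) (half-pos ε>0)
    in M ℕ.⊔ N , λ m n ≤m ≤n →
         +-close (seq x m) (seq x n) (seq y m) (seq y n)
           (h m n (⊔ˡ ≤m) (⊔ˡ ≤n)) (k m n (⊔ʳ {M} ≤m) (⊔ʳ {M} ≤n))

  neg-cauchy : ∀ x → IsCauchy (λ n → ℚ.- seq x n)
  neg-cauchy x ε ε>0 =
    let N , h = cauchy x ε ε>0
    in N , λ m n ≤m ≤n →
         subst (ℚ._< ε) (sym (neg-close (seq x m) (seq x n))) (h m n ≤m ≤n)

  *-cauchy : ∀ x y → IsCauchy (λ n → seq x n ℚ.* seq y n)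
  *-cauchy x y ε ε>0 =
    let B , B>0 , L , b = eventually-bounded₂ x y
        M , h = cauchy x (δ B ε B>0 ε>0) (δ>0 B ε B>0 ε>0)
        N , k = cauchy y (δ B ε B>0 ε>0) (δ>0 B ε B>0 ε>0)
    in L ℕ.⊔ (M ℕ.⊔ N) , λ m n ≤m ≤n →
         *-close B ε B>0 ε>0 (seq x m) (seq x n) (seq y m) (seq y n)
           (proj₁ (b m (⊔ˡ ≤m))) (proj₂ (b n (⊔ˡ ≤n)))
           (h m n (⊔ˡ (⊔ʳ {L} ≤m)) (⊔ˡ (⊔ʳ {L} ≤n)))
           (k m n (⊔ʳ {M} (⊔ʳ {L} ≤m)) (⊔ʳ {M} (⊔ʳ {L} ≤n)))

_+ℝ_ _*ℝ_ : ℝ → ℝ → ℝ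
-ℝ_ : ℝ → ℝ
x +ℝ y = mkℝ (λ n → seq x n ℚ.+ seq y n) (+-cauchy x y)
-ℝ x   = mkℝ (λ n → ℚ.- seq x n) (neg-cauchy x)
x *ℝ y = mkℝ (λ n → seq x n ℚ.* seq y n) (*-cauchy x y)

pointwise : ∀ {x y} → (∀ n → seq x n ≡ seq y n) → x ≈ℝ y
pointwise {x} {y} eq = mk≈ℝ λ ε ε>0 → 0 , λ n _ →
  subst (λ q → ∣ seq x n ℚ.- q ∣ ℚ.< ε) (eq n) (∣p-p∣<ε (seq x n) ε>0)

≈ℝ-isEquivalence : IsEquivalence _≈ℝ_
≈ℝ-isEquivalence = record
  { refl  = pointwise λ _ → refl
  ; sym   = λ {x} {y} x≈y → mk≈ℝ λ ε ε>0 →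
      let N , h = close x≈y ε ε>0
      in N , λ n ≤n → subst (ℚ._< ε) (∣-∣-sym (seq x n) (seq y n)) (h n ≤n)
  ; trans = λ {x} {y} {z} x≈y y≈z → mk≈ℝ λ ε ε>0 →
      let M , h = close x≈y (½ ℚ.* ε) (half-pos ε>0)
          N , k = close y≈z (½ ℚ.* ε) (half-pos ε>0)
      in M ℕ.⊔ N , λ n ≤n →
           trans-close (seq x n) (seq y n) (seq z n) (h n (⊔ˡ ≤n)) (k n (⊔ʳ {M} ≤n))
  }

+ℝ-cong : ∀ {x x′ y y′} → x ≈ℝ x′ → y ≈ℝ y′ → x +ℝ y ≈ℝ x′ +ℝ y′
+ℝ-cong {x} {x′} {y} {y′} x≈ y≈ = mk≈ℝ λ ε ε>0 →
  let M , h = close x≈ (½ ℚ.* ε) (half-pos ε>0)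
      N , k = close y≈ (½ ℚ.* ε) (half-pos ε>0)
  in M ℕ.⊔ N , λ n ≤n →
       +-close (seq x n) (seq x′ n) (seq y n) (seq y′ n) (h n (⊔ˡ ≤n)) (k n (⊔ʳ {M} ≤n))

-ℝ-cong : ∀ {x y} → x ≈ℝ y → -ℝ x ≈ℝ -ℝ y
-ℝ-cong {x} {y} x≈y = mk≈ℝ λ ε ε>0 →
  let N , h = close x≈y ε ε>0
  in N , λ n ≤n → subst (ℚ._< ε) (sym (neg-close (seq x n) (seq y n))) (h n ≤n)

*ℝ-cong : ∀ {x x′ y y′} → x ≈ℝ x′ → y ≈ℝ y′ → x *ℝ y ≈ℝ x′ *ℝ y′
*ℝ-cong {x} {x′} {y} {y′} x≈ y≈ = mk≈ℝ λ ε ε>0 →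
  let B , B>0 , L , b = eventually-bounded₂ x y′
      M , h = close x≈ (δ B ε B>0 ε>0) (δ>0 B ε B>0 ε>0)
      N , k = close y≈ (δ B ε B>0 ε>0) (δ>0 B ε B>0 ε>0)
  in L ℕ.⊔ (M ℕ.⊔ N) , λ n ≤n →
       *-close B ε B>0 ε>0 (seq x n) (seq x′ n) (seq y n) (seq y′ n)
         (proj₁ (b n (⊔ˡ ≤n))) (proj₂ (b n (⊔ˡ ≤n)))
         (h n (⊔ˡ (⊔ʳ {L} ≤n))) (k n (⊔ʳ {M} (⊔ʳ {L} ≤n)))

ℝ-commutativeRing : CommutativeRing 0ℓ 0ℓ
ℝ-commutativeRing = record
  { Carrier = ℝ ; _≈_ = _≈ℝ_ ; _+_ = _+ℝ_ ; _*_ = _*ℝ_ ; -_ = -ℝ_ ; 0# = 0ℝ ; 1# = 1ℝ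
  ; isCommutativeRing = record
    { isRing = record
      { +-isAbelianGroup = record
        { isGroup = record
          { isMonoid = record
            { isSemigroup = record
              { isMagma = record { isEquivalence = ≈ℝ-isEquivalence ; ∙-cong = +ℝ-cong }
              ; assoc = λ x y z → pointwise λ n → ℚ.+-assoc (seq x n) (seq y n) (seq z n)
              }
            ; identity = (λ x → pointwise λ n → ℚ.+-identityˡ (seq x n))
                       , (λ x → pointwise λ n → ℚ.+-identityʳ (seq x n))
            }
          ; inverse = (λ x → pointwise λ n → ℚ.+-inverseˡ (seq x n))
                    , (λ x → pointwise λ n → ℚ.+-inverseʳ (seq x n))
          ; ⁻¹-cong = -ℝ-cong
          }
        ; comm = λ x y → pointwise λ n → ℚ.+-comm (seq x n) (seq y n)
        }
      ; *-cong = *ℝ-cong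
      ; *-assoc = λ x y z → pointwise λ n → ℚ.*-assoc (seq x n) (seq y n) (seq z n)
      ; *-identity = (λ x → pointwise λ n → ℚ.*-identityˡ (seq x n))
                   , (λ x → pointwise λ n → ℚ.*-identityʳ (seq x n))
      ; distrib = (λ x y z → pointwise λ n → ℚ.*-distribˡ-+ (seq x n) (seq y n) (seq z n))
                , (λ x y z → pointwise λ n → ℚ.*-distribʳ-+ (seq x n) (seq y n) (seq z n))
      }
    ; *-comm = λ x y → pointwise λ n → ℚ.*-comm (seq x n) (seq y n)
    }
  }

private
  module ℝ-Ring = CommutativeRing ℝ-commutativeRing

record ℂ : Set where
  constructor _+i_
  field
    re im : ℝ

open ℂ public

infix 4 _≈ℂ_
infixl 6 _+ℂ_
infixl 7 _*ℂ_
infix 8 -ℂ_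

record _≈ℂ_ (z w : ℂ) : Set where
  constructor mk≈ℂ
  field
    re-≈ : re z ≈ℝ re w
    im-≈ : im z ≈ℝ im w

open _≈ℂ_ public

ℝ⇒ℂ : ℝ → ℂ
ℝ⇒ℂ x = x +i 0ℝ

ℚ⇒ℂ : ℚ → ℂ
ℚ⇒ℂ q = ℝ⇒ℂ (ℚ⇒ℝ q)

_+ℂ_ _*ℂ_ : ℂ → ℂ → ℂ
(a +i b) +ℂ (c +i d) = (a +ℝ c) +i (b +ℝ d)
(a +i b) *ℂ (c +i d) = (a *ℝ c +ℝ -ℝ (b *ℝ d)) +i (a *ℝ d +ℝ b *ℝ c)

-ℂ_ : ℂ → ℂ
-ℂ (a +i b) = (-ℝ a) +i (-ℝ b)

private
  module L = Laws ℝ-commutativeRing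

≈ℂ-isEquivalence : IsEquivalence _≈ℂ_
≈ℂ-isEquivalence = record
  { refl  = mk≈ℂ ℝ-Ring.refl ℝ-Ring.refl
  ; sym   = λ p → mk≈ℂ (ℝ-Ring.sym (re-≈ p)) (ℝ-Ring.sym (im-≈ p))
  ; trans = λ p q → mk≈ℂ (ℝ-Ring.trans (re-≈ p) (re-≈ q)) (ℝ-Ring.trans (im-≈ p) (im-≈ q))
  }

private
  module ≈ℂ = IsEquivalence ≈ℂ-isEquivalence

+ℂ-cong : ∀ {z z′ w w′} → z ≈ℂ z′ → w ≈ℂ w′ → z +ℂ w ≈ℂ z′ +ℂ w′
+ℂ-cong p q = mk≈ℂ (+ℝ-cong (re-≈ p) (re-≈ q)) (+ℝ-cong (im-≈ p) (im-≈ q))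

*ℂ-cong : ∀ {z z′ w w′} → z ≈ℂ z′ → w ≈ℂ w′ → z *ℂ w ≈ℂ z′ *ℂ w′
*ℂ-cong p q = mk≈ℂ
  (+ℝ-cong (*ℝ-cong (re-≈ p) (re-≈ q)) (-ℝ-cong (*ℝ-cong (im-≈ p) (im-≈ q))))
  (+ℝ-cong (*ℝ-cong (re-≈ p) (im-≈ q)) (*ℝ-cong (im-≈ p) (re-≈ q)))

*ℂ-comm : ∀ z w → z *ℂ w ≈ℂ w *ℂ z
*ℂ-comm (a +i b) (c +i d) = mk≈ℂ (L.comm-re a b c d) (L.comm-im a b c d)

*ℂ-identityˡ : ∀ z → ℚ⇒ℂ 1ℚ *ℂ z ≈ℂ z
*ℂ-identityˡ (a +i b) = mk≈ℂ (L.identity-re a b) (L.identity-im a b)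

*ℂ-distribˡ : ∀ z w v → z *ℂ (w +ℂ v) ≈ℂ z *ℂ w +ℂ z *ℂ v
*ℂ-distribˡ (a +i b) (c +i d) (e +i f) =
  mk≈ℂ (L.distrib-re a b c d e f) (L.distrib-im a b c d e f)

ℂ-commutativeRing : CommutativeRing 0ℓ 0ℓ
ℂ-commutativeRing = record
  { Carrier = ℂ ; _≈_ = _≈ℂ_ ; _+_ = _+ℂ_ ; _*_ = _*ℂ_ ; -_ = -ℂ_
  ; 0# = ℚ⇒ℂ 0ℚ ; 1# = ℚ⇒ℂ 1ℚ
  ; isCommutativeRing = record
    { isRing = record
      { +-isAbelianGroup = record
        { isGroup = record
          { isMonoid = record
            { isSemigroup = record
              { isMagma = record { isEquivalence = ≈ℂ-isEquivalence ; ∙-cong = +ℂ-cong }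
              ; assoc = λ z w v → mk≈ℂ (ℝ-Ring.+-assoc (re z) (re w) (re v))
                                       (ℝ-Ring.+-assoc (im z) (im w) (im v))
              }
            ; identity = (λ z → mk≈ℂ (ℝ-Ring.+-identityˡ (re z)) (ℝ-Ring.+-identityˡ (im z)))
                       , (λ z → mk≈ℂ (ℝ-Ring.+-identityʳ (re z)) (ℝ-Ring.+-identityʳ (im z)))
            }
          ; inverse = (λ z → mk≈ℂ (ℝ-Ring.-‿inverseˡ (re z)) (ℝ-Ring.-‿inverseˡ (im z)))
                    , (λ z → mk≈ℂ (ℝ-Ring.-‿inverseʳ (re z)) (ℝ-Ring.-‿inverseʳ (im z)))
          ; ⁻¹-cong = λ p → mk≈ℂ (-ℝ-cong (re-≈ p)) (-ℝ-cong (im-≈ p))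
          }
        ; comm = λ z w → mk≈ℂ (ℝ-Ring.+-comm (re z) (re w)) (ℝ-Ring.+-comm (im z) (im w))
        }
      ; *-cong = *ℂ-cong
      ; *-assoc = λ { (a +i b) (c +i d) (e +i f) →
          mk≈ℂ (L.assoc-re a b c d e f) (L.assoc-im a b c d e f) }
      ; *-identity = *ℂ-identityˡ
                   , (λ z → ≈ℂ.trans (*ℂ-comm z (ℚ⇒ℂ 1ℚ)) (*ℂ-identityˡ z))
      ; distrib = *ℂ-distribˡ
                , (λ z w v → ≈ℂ.trans (*ℂ-comm (w +ℂ v) z) $
                     ≈ℂ.trans (*ℂ-distribˡ z w v) (+ℂ-cong (*ℂ-comm z w) (*ℂ-comm z v)))
      }
    ; *-comm = *ℂ-comm
    }
  }

open CommutativeRing ℂ-commutativeRing public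
  using (_≈_; _+_; _-_; _*_; -_; 1#)
open import Algebra.Properties.Semiring.Exp (CommutativeRing.semiring ℂ-commutativeRing) public
  using (_^_)
open import Algebra.Properties.CommutativeMonoid.Sum
  (CommutativeRing.+-commutativeMonoid ℂ-commutativeRing) public
  using (sum⁺-syntax)
open import Algebra.Properties.Semiring.Mult (CommutativeRing.semiring ℂ-commutativeRing)
  as Mult using ()

ℕ⇒ℂ : ℕ → ℂ
ℕ⇒ℂ n = n Mult.× 1#

IsGeneralizedFibonacci : (ℤ → ℂ) → Set
IsGeneralizedFibonacci G = ∀ m → G (m ℤ.+ + 2) ≈ G (m ℤ.+ + 1) + G m

{-# OPTIONS --safe #-}
-- Splitting the last two terms off the sum S n and applying the recurrence to
-- the factor G (n - k) of the others gives
--   S (n + 2) = S (n + 1) + S n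
--               + (-1)^n ((n + 2) G 0 G (n + 2) - (n + 1) G (-1) G (n + 1)).
-- The right-hand side obeys the same recurrence: this is a polynomial identity
-- over ℚ in G (-1), G 0, G n, G (n + 1), n and (-1)^n.
module Submission where

open import Algebra.Bundles using (CommutativeRing)
open import Algebra.Solver.Ring.AlmostCommutativeRing
  using (_-Raw-AlmostCommutative⟶_; fromCommutativeRing; module _-Raw-AlmostCommutative⟶_)
open import Data.Fin.Base using (toℕ)
open import Data.Fin.Properties using (toℕ-inject₁; toℕ-fromℕ; toℕ≤pred[n])
open import Data.Integer.Base as ℤ using (ℤ; +_)
import Data.Integer.Properties as ℤ
import Data.Maybe.Base as Maybe
open import Data.Nat.Base as ℕ using (ℕ; zero; suc; _∸_; _≤_)
import Data.Nat.Properties as ℕ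
open import Data.Rational.Base as ℚ using (½; 1ℚ)
import Data.Rational.Properties as ℚ
open import Function.Base using (_∘_)
open import Level using (0ℓ)
open import Relation.Binary.PropositionalEquality as ≡ using (_≡_)
open import Relation.Nullary.Decidable.Core using (dec⇒maybe)

private
  module Convolution (R : CommutativeRing 0ℓ 0ℓ) where
    open CommutativeRing R hiding (zero)
    open import Algebra.Properties.CommutativeMonoid.Sum +-commutativeMonoid
    open import Algebra.Solver.CommutativeMonoid +-commutativeMonoid
      using (solve; _⊕_; _⊜_)
    open import Relation.Binary.Reasoning.Setoid setoid

    ∑-last : ∀ n (f : ℕ → Carrier) →
      (∑[ k ≤ suc n ] f (toℕ k)) ≈ (∑[ k ≤ n ] f (toℕ k)) + f (suc n)
    ∑-last n f = trans (sum-init-last (f ∘ toℕ {suc (suc n)}))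
      (+-cong (sum-cong-≋ {suc n} (reflexive ∘ ≡.cong f ∘ toℕ-inject₁))
              (reflexive (≡.cong f (toℕ-fromℕ (suc n)))))

    -- Every index satisfies `k ≤ n`, so the truncated difference is the true one.
    convolution : (f g : ℕ → Carrier) → ℕ → Carrier
    convolution f g n = ∑[ k ≤ n ] (f (toℕ k) * g (n ∸ toℕ k))

    -- Here `c` plays the part of g(-1). The last summand on the right is what the terms at `n + 1`
    -- and `n + 2` contribute beyond the two shorter sums.
    convolution-rec : ∀ f g c → g 1 ≈ g 0 + c → (∀ n → g (2 ℕ.+ n) ≈ g (1 ℕ.+ n) + g n) →
      ∀ n → convolution f g (2 ℕ.+ n)
          ≈ convolution f g (1 ℕ.+ n) + convolution f g n
            + (f (2 ℕ.+ n) * g 0 + f (1 ℕ.+ n) * c)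
    convolution-rec f g c g₁ g-rec n = begin
      convolution f g (2 ℕ.+ n)
        ≈⟨ ∑-last (1 ℕ.+ n) (term 2) ⟩
      (∑[ k ≤ 1 ℕ.+ n ] term 2 (toℕ k)) + term 2 (2 ℕ.+ n)
        ≈⟨ +-cong (∑-last n (term 2)) (term-diag 2 (2 ℕ.+ n) 0 (ℕ.n∸n≡0 n)) ⟩
      (∑[ k ≤ n ] term 2 (toℕ k)) + term 2 (1 ℕ.+ n) + f₂ * g 0
        -- For `k ≤ n` the recurrence splits the term; at `k = 1 + n` the factor is `g 1`, which
        -- splits as `g 0 + c`.
        ≈⟨ +-congʳ (+-cong (trans (sum-cong-≋ {suc n} split) (∑-distrib-+ {suc n} (term 1 ∘ toℕ) (term 0 ∘ toℕ)))
                           (trans (term-diag 2 (1 ℕ.+ n) 1 (ℕ.m+n∸n≡m 1 n))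
                                  (trans (*-congˡ g₁) (distribˡ f₁ (g 0) c)))) ⟩
      (S₁ + convolution f g n) + (f₁ * g 0 + f₁ * c) + f₂ * g 0
        -- `S₁` stops at `k = n`; `f₁ * g 0` is the term it lacks to be the full sum for `1 + n`.
        ≈⟨ solve 5 (λ s₁ s₀ p q r →
             ((s₁ ⊕ s₀) ⊕ (p ⊕ q)) ⊕ r ⊜ ((s₁ ⊕ p) ⊕ s₀) ⊕ (r ⊕ q)) refl _ _ _ _ _ ⟩
      (S₁ + f₁ * g 0) + convolution f g n + (f₂ * g 0 + f₁ * c)
        ≈⟨ +-congʳ (+-congʳ (trans (∑-last n (term 1))
             (+-congˡ (term-diag 1 (1 ℕ.+ n) 0 (ℕ.n∸n≡0 n))))) ⟨
      convolution f g (1 ℕ.+ n) + convolution f g n + (f₂ * g 0 + f₁ * c) ∎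
      where
      f₁ = f (1 ℕ.+ n)
      f₂ = f (2 ℕ.+ n)

      term : ℕ → ℕ → Carrier
      term i k = f k * g (i ℕ.+ n ∸ k)

      S₁ = ∑[ k ≤ n ] term 1 (toℕ k)

      term-diag : ∀ i k j → i ℕ.+ n ∸ k ≡ j → term i k ≈ f k * g j
      term-diag i k j eq = reflexive (≡.cong (λ l → f k * g l) eq)

      split : ∀ k → term 2 (toℕ k) ≈ term 1 (toℕ k) + term 0 (toℕ k)
      split i = begin
        f k * g (2 ℕ.+ n ∸ k)                       ≡⟨ ≡.cong (λ l → f k * g l) (ℕ.+-∸-assoc 2 k≤n) ⟩
        f k * g (2 ℕ.+ (n ∸ k))                     ≈⟨ *-congˡ (g-rec (n ∸ k)) ⟩
        f k * (g (1 ℕ.+ (n ∸ k)) + g (n ∸ k))       ≈⟨ distribˡ _ _ _ ⟩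
        f k * g (1 ℕ.+ (n ∸ k)) + f k * g (n ∸ k)   ≡⟨ ≡.cong (λ l → f k * g l + f k * g (n ∸ k)) (ℕ.+-∸-assoc 1 k≤n) ⟨
        f k * g (1 ℕ.+ n ∸ k) + f k * g (n ∸ k)     ∎
        where
        k = toℕ i
        k≤n = toℕ≤pred[n] i

  -- `ι` makes the ring a ℚ-algebra: it gives meaning to 1/2 and 1/4 and lets the solver take its
  -- coefficients in ℚ.
  module ClosedForm (R : CommutativeRing 0ℓ 0ℓ)
    (ι : ℚ.+-*-rawRing -Raw-AlmostCommutative⟶ fromCommutativeRing R) where
    open CommutativeRing R hiding (zero)
    open _-Raw-AlmostCommutative⟶_ ι using (⟦_⟧)
    open import Algebra.Properties.CommutativeMonoid.Sum +-commutativeMonoid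
    open import Algebra.Properties.Semiring.Exp semiring using (_^_)
    open import Algebra.Properties.Semiring.Mult semiring using (_×_)
    open import Algebra.Solver.Ring ℚ.+-*-rawRing (fromCommutativeRing R) ι
      (λ p q → Maybe.map (reflexive ∘ ≡.cong ⟦_⟧) (dec⇒maybe (p ℚ.≟ q)))
      using (Polynomial; solve; con; _:+_; _:*_; _:-_; :-_; _:^_; _:=_)
    open import Relation.Binary.Reasoning.Setoid setoid
    open Convolution R

    -- a, b, c and d stand for G 0, G 1, G (-1) and G 2; ε, N, x and y for
    -- (-1)^n, n, G n and G (n + 1).
    closed : (a b c d ε N x y : Carrier) → Carrier
    closed a b c d ε N x y =
      - 1# * ε * ⟦ ½ ⟧ * N * (c * x - a * y)
      + ⟦ + 1 ℚ./ 4 ⟧ * (1# - ε) * (d * x - (c + b) * y)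

    closed-cong : ∀ {a b b′ c d d′ ε N x x′ y y′} → b ≈ b′ → d ≈ d′ → x ≈ x′ → y ≈ y′ →
      closed a b c d ε N x y ≈ closed a b′ c d′ ε N x′ y′
    closed-cong b≈ d≈ x≈ y≈ = +-cong
      (*-congˡ (+-cong (*-congˡ x≈) (-‿cong (*-congˡ y≈))))
      (*-congˡ (+-cong (*-cong d≈ x≈) (-‿cong (*-cong (+-congˡ b≈) y≈))))

    private
      -- con 1ℚ would denote ⟦ 1ℚ ⟧, which is not 1# by computation.
      one : ∀ {n} → Polynomial n
      one = con 1ℚ :^ 0

      -- Follows the shape of `closed` exactly, so that it evaluates to `closed` by computation.
      closedᵖ : ∀ {n} (a b c d ε N x y : Polynomial n) → Polynomial n
      closedᵖ a b c d ε N x y =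
        (:- one) :* ε :* con ½ :* N :* (c :* x :- a :* y)
        :+ con (+ 1 ℚ./ 4) :* (one :- ε) :* (d :* x :- (c :+ b) :* y)

    -- Passing from n to n + 1 replaces `ε` by `- 1# * ε`, `N` by `1# + N` and `(x , y)` by
    -- `(y , y + x)`. Both sides have degree at most one in `ε`, which can therefore stay a free
    -- variable.
    closed-rec : ∀ a c ε N x y → let b = a + c; d = b + a; z = y + x in
      closed a b c d (- 1# * ε) (1# + N) y z + closed a b c d ε N x y
        + (- 1# * (- 1# * ε) * (1# + (1# + N)) * z * a + - 1# * ε * (1# + N) * y * c)
      ≈ closed a b c d (- 1# * (- 1# * ε)) (1# + (1# + N)) z (z + y)
    closed-rec = solve 6 (λ a c ε N x y →
      let b = a :+ c; d = b :+ a; z = y :+ x; -ε = (:- one) :* ε in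
      closedᵖ a b c d -ε (one :+ N) y z :+ closedᵖ a b c d ε N x y
        :+ ((:- one) :* -ε :* (one :+ (one :+ N)) :* z :* a :+ -ε :* (one :+ N) :* y :* c)
      := closedᵖ a b c d ((:- one) :* -ε) (one :+ (one :+ N)) z (z :+ y)) refl

    -- In the two base identities o stands for 0#, which is not the value of a
    -- constant of the solver: the terms in which it occurs are collected.
    closed₀ : ∀ a c o → let b = a + c; d = b + a in
      1# * o * a * a + o
      ≈ closed a b c d 1# o a b + o * (a * a + 1# + ⟦ ½ ⟧ * (c * a - a * b))
    closed₀ = solve 3 (λ a c o → let b = a :+ c; d = b :+ a in
      one :* o :* a :* a :+ o
      := closedᵖ a b c d one o a b
         :+ o :* (a :* a :+ one :+ con ½ :* (c :* a :- a :* b))) refl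

    closed₁ : ∀ a c o → let b = a + c; d = b + a in
      1# * o * a * b + (- 1# * 1# * (1# + o) * b * a + o)
      ≈ closed a b c d (- 1# * 1#) (1# + o) b d + o * (1# - ⟦ ½ ⟧ * (c * b - a * d))
    closed₁ = solve 3 (λ a c o → let b = a :+ c; d = b :+ a in
      one :* o :* a :* b :+ ((:- one) :* one :* (one :+ o) :* b :* a :+ o)
      := closedᵖ a b c d ((:- one) :* one) (one :+ o) b d
         :+ o :* (one :- con ½ :* (c :* b :- a :* d))) refl

    drop-zero : ∀ x y → x + 0# * y ≈ x
    drop-zero x y = trans (+-congˡ (zeroˡ y)) (+-identityʳ x)

    weighted : (ℕ → Carrier) → ℕ → Carrier
    weighted g k = (- 1#) ^ k * (k × 1#) * g k

    module _ (g : ℕ → Carrier) (c : Carrier) (g₁ : g 1 ≈ g 0 + c)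
             (g-rec : ∀ n → g (2 ℕ.+ n) ≈ g (1 ℕ.+ n) + g n) where

      private
        g₂ : g 2 ≈ g 0 + c + g 0
        g₂ = trans (g-rec 0) (+-congʳ g₁)

      -- Both sides obey the same second-order recurrence, hence an induction with two base cases.
      convolution-closed : ∀ n → convolution (weighted g) g n
        ≈ closed (g 0) (g 1) c (g 2) ((- 1#) ^ n) (n × 1#) (g n) (g (1 ℕ.+ n))
      convolution-closed zero = begin
        convolution (weighted g) g 0
          -- `0#` is here both the factor `0 × 1#` and the empty tail of the sum.
          ≈⟨ closed₀ (g 0) c 0# ⟩
        closed (g 0) (g 0 + c) c (g 0 + c + g 0) 1# 0# (g 0) (g 0 + c) + 0# * _
          ≈⟨ drop-zero _ _ ⟩
        closed (g 0) (g 0 + c) c (g 0 + c + g 0) 1# 0# (g 0) (g 0 + c)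
          ≈⟨ closed-cong g₁ g₂ refl g₁ ⟨
        closed (g 0) (g 1) c (g 2) 1# 0# (g 0) (g 1) ∎
      convolution-closed (suc zero) = begin
        convolution (weighted g) g 1
          ≈⟨ +-cong (*-congˡ g₁) (+-congʳ (*-congʳ (*-congˡ g₁))) ⟩
        -- `1 × 1#` unfolds to `1# + 0#`.
        _ ≈⟨ closed₁ (g 0) c 0# ⟩
        closed (g 0) (g 0 + c) c (g 0 + c + g 0) (- 1# * 1#) (1 × 1#) (g 0 + c) (g 0 + c + g 0) + 0# * _
          ≈⟨ drop-zero _ _ ⟩
        closed (g 0) (g 0 + c) c (g 0 + c + g 0) (- 1# * 1#) (1 × 1#) (g 0 + c) (g 0 + c + g 0)
          ≈⟨ closed-cong g₁ g₂ g₁ g₂ ⟨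
        closed (g 0) (g 1) c (g 2) (- 1# * 1#) (1 × 1#) (g 1) (g 2) ∎
      convolution-closed (suc (suc n)) = begin
        convolution (weighted g) g (2 ℕ.+ n)
          ≈⟨ convolution-rec (weighted g) g c g₁ g-rec n ⟩
        convolution (weighted g) g (1 ℕ.+ n) + convolution (weighted g) g n
          + (weighted g (2 ℕ.+ n) * g 0 + weighted g (1 ℕ.+ n) * c)
          -- All values of `g` are reduced to `g 0`, `c`, `g n` and `g (1 + n)`, the variables of
          -- `closed-rec`.
          ≈⟨ +-cong (+-cong
               (trans (convolution-closed (suc n)) (closed-cong g₁ g₂ refl (g-rec n)))
               (trans (convolution-closed n) (closed-cong g₁ g₂ refl refl)))
               (+-congʳ (*-congʳ (*-congˡ (g-rec n)))) ⟩
        _ ≈⟨ closed-rec (g 0) c ((- 1#) ^ n) (n × 1#) (g n) (g (1 ℕ.+ n)) ⟩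
        _ ≈⟨ closed-cong g₁ g₂ (g-rec n) (trans (g-rec (1 ℕ.+ n)) (+-congʳ (g-rec n))) ⟨
        closed (g 0) (g 1) c (g 2) ((- 1#) ^ (2 ℕ.+ n)) ((2 ℕ.+ n) × 1#)
          (g (2 ℕ.+ n)) (g (3 ℕ.+ n)) ∎

    weighted-sum : (G : ℤ → Carrier) → (∀ m → G (m ℤ.+ + 2) ≈ G (m ℤ.+ + 1) + G m) → (n : ℕ) →
      (∑[ k ≤ n ] ((- 1#) ^ toℕ k * (toℕ k × 1#) * G (+ toℕ k) * G (+ n ℤ.- + toℕ k)))
        ≈ (- 1#) ^ (n ℕ.+ 1) * ⟦ ½ ⟧ * (n × 1#) * (G ℤ.-1ℤ * G (+ n) - G (+ 0) * G (+ n ℤ.+ + 1))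
          + ⟦ + 1 ℚ./ 4 ⟧ * (1# - (- 1#) ^ n)
            * (G (+ 2) * G (+ n) - (G ℤ.-1ℤ + G (+ 1)) * G (+ n ℤ.+ + 1))
    -- With `1 + n` for `n + 1` the power of -1 unfolds to `- 1# * (- 1#) ^ n`, as in `closed`.
    weighted-sum G G-rec n rewrite ℕ.+-comm n 1 = trans
      (sum-cong-≋ {suc n} λ k → *-congˡ {weighted (G ∘ +_) (toℕ k)} (reflexive (≡.cong G (+n-+k (toℕ≤pred[n] k)))))
      -- The recurrence at -1 says that `c` may be G(-1).
      (convolution-closed (G ∘ +_) (G ℤ.-1ℤ) (G-rec ℤ.-1ℤ) g-rec n)
      where
      +n-+k : ∀ {k} → k ≤ n → + n ℤ.- + k ≡ + (n ∸ k)
      +n-+k {k} k≤n = ≡.trans (ℤ.m-n≡m⊖n n k) (ℤ.⊖-≥ k≤n)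

      g-rec : ∀ m → G (+ (2 ℕ.+ m)) ≈ G (+ (1 ℕ.+ m)) + G (+ m)
      g-rec m = ≡.subst₂ (λ i j → G (+ i) ≈ G (+ j) + G (+ m)) (ℕ.+-comm m 2) (ℕ.+-comm m 1) (G-rec (+ m))

open import Defs

private
  ℚ⇒ℂ-homomorphism : ℚ.+-*-rawRing -Raw-AlmostCommutative⟶ fromCommutativeRing ℂ-commutativeRing
  ℚ⇒ℂ-homomorphism = record
    { ⟦_⟧    = ℚ⇒ℂ
    ; +-homo = λ p q → mk≈ℂ (pointwise λ _ → ≡.refl) (pointwise λ _ → ≡.refl)
    -- The product of p + 0i and q + 0i is (pq - 0) + (p0 + 0q)i.
    ; *-homo = λ p q → mk≈ℂ (pointwise λ _ → ≡.sym (ℚ.+-identityʳ (p ℚ.* q)))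
        (pointwise λ _ → ≡.sym (≡.cong₂ ℚ._+_ (ℚ.*-zeroʳ p) (ℚ.*-zeroˡ q)))
    ; -‿homo = λ p → mk≈ℂ (pointwise λ _ → ≡.refl) (pointwise λ _ → ≡.refl)
    ; 0-homo = CommutativeRing.refl ℂ-commutativeRing
    ; 1-homo = CommutativeRing.refl ℂ-commutativeRing
    }

mainTheorem13 : (G : ℤ → ℂ) → IsGeneralizedFibonacci G → (n : ℕ) →
    (∑[ k ≤ n ] ((- 1#) ^ toℕ k * ℕ⇒ℂ (toℕ k) * G (+ toℕ k) * G (+ n ℤ.- + toℕ k)))
    ≈ (- 1#) ^ (n ℕ.+ 1) * ℚ⇒ℂ ½ * ℕ⇒ℂ n * (G ℤ.-1ℤ * G (+ n) - G (+ 0) * G (+ n ℤ.+ + 1))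
    + ℚ⇒ℂ (+ 1 ℚ./ 4) * (1# - (- 1#) ^ n)
    * (G (+ 2) * G (+ n) - (G ℤ.-1ℤ + G (+ 1)) * G (+ n ℤ.+ + 1))
mainTheorem13 = ClosedForm.weighted-sum ℂ-commutativeRing ℚ⇒ℂ-homomorphism
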